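{- Let $n\ge 3$. For every initial coloring of the cycle $C_n$, the stabilization time of the Majority Model (MM) is at most $\lceil n/2\rceil-1$, and this bound is tight, i.e., there is an initial coloring of $C_n$ for which the stabilization time equals $\lceil n/2\rceil-1$.
   Context: A coloring of a graph is a map from its nodes to $\{b,w\}$. In the Majority Model (MM), all nodes update simultaneously in each round: a node adopts the color strictly more frequent among its neighbors in the previous round, and keeps its current color in case of a tie. Since MM is deterministic and there are finitely many colorings, from any initial coloring the sequence of colorings eventually enters a cycle of colorings; the stabilization time is the number of rounds needed to reach this cycle. -}

module Defs where

open import Data.Bool using (if_then_else_)
open import Data.Fin using (Fin; toℕ)
open import Data.List using (List; allFin; filter; length)
open import Data.Nat using (ℕ; suc; _<_; _≤_; _<?_; _≟_; s≤s)
open import Data.Nat.GeneralisedArithmetic using (fold)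
open import Data.Nat.Properties using (1+n≢n)
open import Data.Product using (_×_; _,_; ∃-syntax)
open import Data.Sum using (_⊎_; inj₁; inj₂; swap)
open import Relation.Binary.Definitions using (Decidable; DecidableEquality; Irreflexive; Symmetric)
open import Relation.Binary.PropositionalEquality using (_≡_; _≗_; refl; sym; trans; cong)
open import Relation.Nullary using (¬_; yes; no; does)
open import Relation.Nullary.Decidable using (_×-dec_; _⊎-dec_)

data Color : Set where
  black white : Color

infix 4 _≟ᶜ_
_≟ᶜ_ : DecidableEquality Color
black ≟ᶜ black = yes refl
black ≟ᶜ white = no λ ()
white ≟ᶜ black = no λ ()
white ≟ᶜ white = yes refl

record Graph (n : ℕ) : Set₁ where
  field
    Adj        : Fin n → Fin n → Set
    adj?       : Decidable Adj
    adj-sym    : Symmetric Adj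
    adj-irrefl : Irreflexive _≡_ Adj

Coloring : ℕ → Set
Coloring n = Fin n → Color

module MajorityModel {n : ℕ} (G : Graph n) where
  open Graph G

  neighbors : Fin n → List (Fin n)
  neighbors v = filter (adj? v) (allFin n)

  #neighbors : Coloring n → Color → Fin n → ℕ
  #neighbors c x v = length (filter (λ u → c u ≟ᶜ x) (neighbors v))

  round : Coloring n → Coloring n
  round c v =
    if does (#neighbors c white v <? #neighbors c black v) then black
    else if does (#neighbors c black v <? #neighbors c white v) then white
    else c v

  after : ℕ → Coloring n → Coloring n
  after t c = fold c round t

  -- c lies on a cycle of colorings.  Colorings are functions, so they are
  -- compared pointwise.
  Recurrent : Coloring n → Set
  Recurrent c = ∃[ p ] (0 < p × after p c ≗ c)

  IsStabilizationTime : Coloring n → ℕ → Set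
  IsStabilizationTime c t =
    Recurrent (after t c) × (∀ s → Recurrent (after s c) → t ≤ s)

-- Next i j says j = i + 1 modulo n.
Next : ∀ {n} → Fin n → Fin n → Set
Next {n} i j = suc (toℕ i) ≡ toℕ j ⊎ (suc (toℕ i) ≡ n × toℕ j ≡ 0)

next? : ∀ {n} → Decidable (Next {n})
next? {n} i j = (suc (toℕ i) ≟ toℕ j) ⊎-dec ((suc (toℕ i) ≟ n) ×-dec (toℕ j ≟ 0))

next-irrefl : ∀ {n} → 3 ≤ n → (i : Fin n) → ¬ Next i i
next-irrefl _ i (inj₁ e) = 1+n≢n e
next-irrefl 3≤n i (inj₂ (e , z)) with refl ← trans (sym e) (cong suc z) | s≤s () ← 3≤n

cycleGraph : (n : ℕ) → 3 ≤ n → Graph n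
cycleGraph n 3≤n = record
  { Adj        = λ i j → Next i j ⊎ Next j i
  ; adj?       = λ i j → next? i j ⊎-dec next? j i
  ; adj-sym    = swap
  ; adj-irrefl = λ { {i} refl (inj₁ p) → next-irrefl 3≤n i p
                   ; {i} refl (inj₂ p) → next-irrefl 3≤n i p }
  }

{-# OPTIONS --safe #-}
module Submission where

-- On a cycle a round replaces every color by the median of three consecutive colors, so exactly
-- the isolated nodes (those differing from both neighbors) change.  A node is isolated after t
-- rounds iff the path of radius t + 1 around it alternates initially.  For t = ⌈n/2⌉ − 1 that
-- path runs through all edges, so by then the coloring is fixed unless it alternated all around
-- from the start, in which case it has period 2 at once.  Conversely the centre of an initially
-- alternating path with 2 (⌈n/2⌉ − 1) edges keeps changing up to round ⌈n/2⌉ − 1.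

open import Data.Bool using (if_then_else_; true; false)
open import Data.Empty using (⊥)
open import Data.Fin using (Fin; toℕ)
open import Data.Fin.Properties using (all?; ¬∀⟶∃¬; toℕ-injective; toℕ<n; toℕ-fromℕ<)
open import Data.List using (List; allFin; filter; length; map; _∷_; [])
open import Data.List.Membership.Propositional using (_∈_)
open import Data.List.Membership.Propositional.Properties using (∈-allFin; ∈-filter⁺; ∈-filter⁻)
open import Data.List.Membership.Propositional.Properties.WithK using (unique∧set⇒bag)
open import Data.List.Relation.Binary.BagAndSetEquality using (∼bag⇒↭)
open import Data.List.Relation.Binary.Permutation.Propositional using (_↭_)
open import Data.List.Relation.Binary.Permutation.Propositional.Properties using (filter-↭; ↭-length)
open import Data.List.Relation.Unary.All using ([]; _∷_)
open import Data.List.Relation.Unary.AllPairs using ([]; _∷_)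
open import Data.List.Relation.Unary.Any using (here; there)
open import Data.List.Relation.Unary.Unique.Propositional.Properties using (allFin⁺; filter⁺)
open import Data.Nat using (ℕ; NonZero; zero; suc; pred; _+_; _*_; _∸_; _⊓_; _≤_; _<_; _<?_; z≤n; s≤s; ⌈_/2⌉; ⌊_/2⌋)
open import Data.Nat.DivMod using (_/_; _%_; _mod_; %-distribˡ-+; [m+kn]%n≡m%n; m%n<n; m<n⇒m%n≡m; m≡m%n+[m/n]*n; n%n≡0)
open import Data.Nat.GeneralisedArithmetic using (fold-+)
open import Data.Nat.Properties
open import Data.Product using (_×_; _,_; ∃-syntax; proj₁; proj₂)
open import Data.Sum using (_⊎_; inj₁; inj₂)
open import Data.Unit using (⊤)
open import Function using (_∘_; mk⇔)
open import Relation.Binary.PropositionalEquality using (_≡_; _≢_; _≗_; refl; sym; trans; cong; cong-app; subst; subst₂; module ≡-Reasoning)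
open import Relation.Nullary using (Dec; does; ¬_; yes; no; contradiction)
open import Relation.Nullary.Decidable using (map′; from-yes; ¬?; _×-dec_; _→-dec_)
open import Relation.Unary using (Pred; Decidable)
open import Defs

-- Least witnesses and bounds on halving.

least : ∀ {p} {P : Pred ℕ p} → Decidable P → ∀ b → P b →
        ∃[ t ] (P t × t ≤ b × (∀ s → P s → t ≤ s))
least P? b Pb with P? 0
... | yes P0 = 0 , P0 , z≤n , λ _ _ → z≤n
least P? zero    Pb | no ¬P0 = contradiction Pb ¬P0
least P? (suc b) Pb | no ¬P0 with least (P? ∘ suc) b Pb
... | t , Pt , t≤b , t-min = suc t , Pt , s≤s t≤b , λ
  { zero    P0 → contradiction P0 ¬P0
  ; (suc s) Ps → s≤s (t-min s Ps) }

⌊k/2⌋*2≤k : ∀ k → ⌊ k /2⌋ * 2 ≤ k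
⌊k/2⌋*2≤k 0             = z≤n
⌊k/2⌋*2≤k 1             = z≤n
⌊k/2⌋*2≤k (suc (suc k)) = s≤s (s≤s (⌊k/2⌋*2≤k k))

k≤1+⌊k/2⌋*2 : ∀ k → k ≤ suc (⌊ k /2⌋ * 2)
k≤1+⌊k/2⌋*2 0             = z≤n
k≤1+⌊k/2⌋*2 1             = s≤s z≤n
k≤1+⌊k/2⌋*2 (suc (suc k)) = s≤s (s≤s (k≤1+⌊k/2⌋*2 k))

-- Medians of colors, with identities decided by finite checks.

∀ᶜ? : ∀ {p} {P : Pred Color p} → Decidable P → Dec (∀ x → P x)
∀ᶜ? P? = map′ (λ { (b , w) black → b ; (b , w) white → w }) (λ f → f black , f white)
              (P? black ×-dec P? white)

maj : Color → Color → Color → Color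
maj black _ black = black
maj white _ white = white
maj black x white = x
maj white x black = x

infix 4 _≢?_
_≢?_ : (x y : Color) → Dec (x ≢ y)
x ≢? y = ¬? (x ≟ᶜ y)

maj-cong : ∀ {a a′ b b′ c c′} → a ≡ a′ → b ≡ b′ → c ≡ c′ → maj a b c ≡ maj a′ b′ c′
maj-cong refl refl refl = refl

# : Color → List Color → ℕ
# x = length ∘ filter (_≟ᶜ x)

length-filter-colored : ∀ {n} (c : Coloring n) x vs →
                        length (filter (λ v → c v ≟ᶜ x) vs) ≡ # x (map c vs)
length-filter-colored c x []       = refl
length-filter-colored c x (v ∷ vs) with does (c v ≟ᶜ x)
... | true  = cong suc (length-filter-colored c x vs)
... | false = length-filter-colored c x vs

majority-of-two : ∀ a x b → let cs = a ∷ b ∷ [] in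
  (if does (# white cs <? # black cs) then black
   else if does (# black cs <? # white cs) then white
   else x) ≡ maj a x b
majority-of-two black x black = refl
majority-of-two black x white = refl
majority-of-two white x black = refl
majority-of-two white x white = refl

maj≢⇒isolated : ∀ a b c → maj a b c ≢ b → a ≢ b × b ≢ c
maj≢⇒isolated = from-yes (∀ᶜ? λ a → ∀ᶜ? λ b → ∀ᶜ? λ c →
  maj a b c ≢? b →-dec a ≢? b ×-dec b ≢? c)

isolated⇒maj≢ : ∀ a b c → a ≢ b × b ≢ c → maj a b c ≢ b
isolated⇒maj≢ = from-yes (∀ᶜ? λ a → ∀ᶜ? λ b → ∀ᶜ? λ c →
  (a ≢? b ×-dec b ≢? c) →-dec maj a b c ≢? b)

-- Decided over all 32 windows. This drives the induction backwards in time: if a node is isolated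
-- after a round, then it and both its neighbors were isolated before.
maj-isolated⇒alternating : ∀ a b c d e → maj a b c ≢ maj b c d × maj b c d ≢ maj c d e →
                           a ≢ b × b ≢ c × c ≢ d × d ≢ e
maj-isolated⇒alternating =
  from-yes (∀ᶜ? λ a → ∀ᶜ? λ b → ∀ᶜ? λ c → ∀ᶜ? λ d → ∀ᶜ? λ e →
    (maj a b c ≢? maj b c d ×-dec maj b c d ≢? maj c d e) →-dec
    a ≢? b ×-dec b ≢? c ×-dec c ≢? d ×-dec d ≢? e)

alternating⇒maj≢maj : ∀ a b c d → a ≢ b × b ≢ c × c ≢ d → maj a b c ≢ maj b c d
alternating⇒maj≢maj =
  from-yes (∀ᶜ? λ a → ∀ᶜ? λ b → ∀ᶜ? λ c → ∀ᶜ? λ d →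
    (a ≢? b ×-dec b ≢? c ×-dec c ≢? d) →-dec maj a b c ≢? maj b c d)

-- The three inner nodes all flip in the first round, so they still alternate and the centre flips
-- back in the second.
alternating⇒maj∘maj : ∀ a b c d e → a ≢ b × b ≢ c × c ≢ d × d ≢ e →
                      maj (maj a b c) (maj b c d) (maj c d e) ≡ c
alternating⇒maj∘maj =
  from-yes (∀ᶜ? λ a → ∀ᶜ? λ b → ∀ᶜ? λ c → ∀ᶜ? λ d → ∀ᶜ? λ e →
    (a ≢? b ×-dec b ≢? c ×-dec c ≢? d ×-dec d ≢? e) →-dec
    maj (maj a b c) (maj b c d) (maj c d e) ≟ᶜ c)

-- Alternating stretches of color sequences.

-- The length `m` counts edges, so the stretch has `m + 1` positions.
Alternates : (ℕ → Color) → ℕ → ℕ → Set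
Alternates z k zero    = ⊤
Alternates z k (suc m) = z k ≢ z (suc k) × Alternates z (suc k) m

Alternates-lookup : ∀ {z} k {m j} → Alternates z k m → j < m → z (j + k) ≢ z (suc (j + k))
Alternates-lookup k {suc m} {zero}  (p , _) _ = p
Alternates-lookup {z} k {suc m} {suc j} (_ , a) (s≤s j<m) =
  subst (λ i → z i ≢ z (suc i)) (+-suc j k) (Alternates-lookup (suc k) a j<m)

Alternates-tabulate : ∀ {z} k m → (∀ j → j < m → z (j + k) ≢ z (suc (j + k))) → Alternates z k m
Alternates-tabulate k zero    f = _
Alternates-tabulate {z} k (suc m) f = f 0 (s≤s z≤n) , Alternates-tabulate (suc k) m λ j j<m →
  subst (λ i → z i ≢ z (suc i)) (sym (+-suc j k)) (f (suc j) (s≤s j<m))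

Alternates-resp-≗ : ∀ {y z} → y ≗ z → ∀ k m → Alternates y k m → Alternates z k m
Alternates-resp-≗ y≗z k zero    _       = _
Alternates-resp-≗ y≗z k (suc m) (p , a) =
  subst₂ _≢_ (y≗z k) (y≗z (suc k)) p , Alternates-resp-≗ y≗z (suc k) m a

-- Position k of the new sequence is centred at position k + 1 of the old one.
step : (ℕ → Color) → ℕ → Color
step z k = maj (z k) (z (suc k)) (z (2 + k))

-- Two new edges are the least that work: black, black, white, white has differing medians without
-- alternating. Each further new edge contributes one further old edge.
Alternates-step⁻ : ∀ z k m → Alternates (step z) k (2 + m) → Alternates z k (4 + m)
Alternates-step⁻ z k zero (p , q , _)
  with a , b , c , d ← maj-isolated⇒alternating _ _ _ _ _ (p , q) = a , b , c , d , _
Alternates-step⁻ z k (suc m) (p , as@(q , _)) =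
  proj₁ (maj-isolated⇒alternating _ _ _ (z (3 + k)) (z (4 + k)) (p , q)) ,
  Alternates-step⁻ z (suc k) m as

Alternates-step⁺ : ∀ z k m → Alternates z k (2 + m) → Alternates (step z) k m
Alternates-step⁺ z k zero    _ = _
Alternates-step⁺ z k (suc m) (a , as@(b , c , _)) =
  alternating⇒maj≢maj _ _ _ _ (a , b , c) , Alternates-step⁺ z (suc k) m as

striped : ℕ → Color
striped 0             = black
striped 1             = white
striped (suc (suc i)) = striped i

striped-alternates : ∀ i → striped i ≢ striped (suc i)
striped-alternates 0             ()
striped-alternates 1             ()
striped-alternates (suc (suc i)) = striped-alternates i

striped-even : ∀ k → striped (k * 2) ≡ black
striped-even zero    = refl
striped-even (suc k) = striped-even k

-- The successor relation on the cycle.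

Next-functional : ∀ {n} {i j j′ : Fin n} → Next i j → Next i j′ → j ≡ j′
Next-functional (inj₁ e)       (inj₁ e′)       = toℕ-injective (trans (sym e) e′)
Next-functional {j = j} (inj₁ e) (inj₂ (w , _)) = contradiction (trans (sym e) w) (<⇒≢ (toℕ<n j))
Next-functional {j′ = j} (inj₂ (w , _)) (inj₁ e) = contradiction (trans (sym e) w) (<⇒≢ (toℕ<n j))
Next-functional (inj₂ (_ , z)) (inj₂ (_ , z′)) = toℕ-injective (trans z (sym z′))

Next-injective : ∀ {n} {i i′ j : Fin n} → Next i j → Next i′ j → i ≡ i′
Next-injective (inj₁ e)       (inj₁ e′)       = toℕ-injective (suc-injective (trans e (sym e′)))
Next-injective (inj₁ e)       (inj₂ (_ , z))  = contradiction (trans e z) λ ()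
Next-injective (inj₂ (_ , z)) (inj₁ e)        = contradiction (trans e z) λ ()
Next-injective (inj₂ (w , _)) (inj₂ (w′ , _)) = toℕ-injective (suc-injective (trans w (sym w′)))

Next-asym : ∀ {n} {i j : Fin n} → 3 ≤ n → Next i j → Next j i → ⊥
Next-asym _ (inj₁ e) (inj₁ f) = m≢1+n+m _ (sym (trans (cong suc e) f))
Next-asym 3≤n (inj₁ e) (inj₂ (w , z)) =
  <⇒≢ 3≤n (trans (cong (suc ∘ suc) (sym z)) (trans (cong suc e) w))
Next-asym 3≤n (inj₂ (w , z)) (inj₁ f) =
  <⇒≢ 3≤n (trans (cong (suc ∘ suc) (sym z)) (trans (cong suc f) w))
Next-asym 3≤n (inj₂ (w , z)) (inj₂ (w′ , z′)) =
  <⇒≢ (≤-trans (s≤s (s≤s z≤n)) 3≤n) (trans (cong suc (sym z′)) w)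

-- The cycle unrolled to the natural numbers.

module Nodes (n : ℕ) .{{_ : NonZero n}} where

  -- Positions range over all naturals, so the neighbors of position `k + 1` are at `k` and `k + 2`
  -- with no wrap-around case.
  node : ℕ → Fin n
  node k = k mod n

  toℕ-node : ∀ k → toℕ (node k) ≡ k % n
  toℕ-node k = toℕ-fromℕ< (m%n<n k n)

  node-toℕ : ∀ v → node (toℕ v) ≡ v
  node-toℕ v = toℕ-injective (trans (toℕ-node (toℕ v)) (m<n⇒m%n≡m (toℕ<n v)))

  node-periodic : ∀ k l → node (k + l * n) ≡ node k
  node-periodic k l = toℕ-injective
    (trans (toℕ-node (k + l * n)) (trans ([m+kn]%n≡m%n k l n) (sym (toℕ-node k))))

  toℕ-node-suc : 1 < n → ∀ k → toℕ (node (suc k)) ≡ suc (toℕ (node k)) % n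
  toℕ-node-suc 1<n k = begin
    toℕ (node (suc k))       ≡⟨ toℕ-node (suc k) ⟩
    (1 + k) % n              ≡⟨ %-distribˡ-+ 1 k n ⟩
    (1 % n + k % n) % n      ≡⟨ cong (λ i → (i + k % n) % n) (m<n⇒m%n≡m 1<n) ⟩
    suc (k % n) % n          ≡⟨ cong (λ i → suc i % n) (toℕ-node k) ⟨
    suc (toℕ (node k)) % n   ∎
    where open ≡-Reasoning

  Next-node : 1 < n → ∀ k → Next (node k) (node (suc k))
  Next-node 1<n k with m≤n⇒m<n∨m≡n (toℕ<n (node k))
  ... | inj₁ lt = inj₁ (sym (trans (toℕ-node-suc 1<n k) (m<n⇒m%n≡m lt)))
  ... | inj₂ eq = inj₂ (eq , trans (toℕ-node-suc 1<n k) (trans (cong (_% n) eq) (n%n≡0 n)))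

  -- Every position has a representative far enough to the right to be the tip of a light cone.
  shifted : ∀ m i → ∃[ k ] k + m ≡ i + m * n
  shifted m i = i + m * n ∸ m , m∸n+n≡m (≤-trans (m≤m*n m n) (m≤n+m (m * n) i))

  node-surjective : ∀ m v → ∃[ k ] node (k + m) ≡ v
  node-surjective m v with k , eq ← shifted m (toℕ v) =
    k , trans (cong node eq) (trans (node-periodic (toℕ v) m) (node-toℕ v))

  ∀-node : ∀ {p} {P : Pred (Fin n) p} d → (∀ k → P (node (d + k))) → ∀ v → P v
  ∀-node {P = P} d f v with k , eq ← node-surjective d v =
    subst P (trans (cong node (+-comm d k)) eq) (f k)

  -- This is all that the dynamics needs to know about the graph. Centring at `suc k` avoids
  -- subtraction for the left neighbor.
  RoundIsMedian : Graph n → Set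
  RoundIsMedian G = ∀ c k →
    MajorityModel.round G c (node (suc k)) ≡ maj (c (node k)) (c (node (suc k))) (c (node (2 + k)))

-- Rounds on the cycle are medians.

module CycleGraph (n : ℕ) .{{_ : NonZero n}} (3≤n : 3 ≤ n) where

  open Nodes n
  open MajorityModel (cycleGraph n 3≤n)

  -- Wrap-around affects the order in which the two neighbors are listed, but counting is invariant
  -- under permutation. Both lists are duplicate-free with the same members; `3 ≤ n` keeps the two
  -- neighbors distinct.
  neighbors-node : ∀ k → neighbors (node (suc k)) ↭ node k ∷ node (2 + k) ∷ []
  neighbors-node k = ∼bag⇒↭ (unique∧set⇒bag (filter⁺ _ (allFin⁺ n)) ((l≢r ∷ []) ∷ [] ∷ [])
    (mk⇔ (to ∘ proj₂ ∘ ∈-filter⁻ _ {xs = allFin n}) (∈-filter⁺ _ (∈-allFin _) ∘ from)))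
    where
    v = node (suc k)

    next : ∀ i → Next (node i) (node (suc i))
    next = Next-node (≤-trans (s≤s (s≤s z≤n)) 3≤n)

    l≢r : node k ≢ node (2 + k)
    l≢r eq = Next-asym 3≤n (next k) (subst (Next v) (sym eq) (next (suc k)))

    to : ∀ {u} → Next v u ⊎ Next u v → u ∈ node k ∷ node (2 + k) ∷ []
    to (inj₁ vu) = there (here (Next-functional vu (next (suc k))))
    to (inj₂ uv) = here (Next-injective uv (next k))

    from : ∀ {u} → u ∈ node k ∷ node (2 + k) ∷ [] → Next v u ⊎ Next u v
    from (here refl)         = inj₂ (next k)
    from (there (here refl)) = inj₁ (next (suc k))

  #neighbors-node : ∀ c x k → #neighbors c x (node (suc k)) ≡ # x (c (node k) ∷ c (node (2 + k)) ∷ [])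
  #neighbors-node c x k = trans (↭-length (filter-↭ (λ u → c u ≟ᶜ x) (neighbors-node k)))
    (length-filter-colored c x (node k ∷ node (2 + k) ∷ []))

  round-node : RoundIsMedian (cycleGraph n 3≤n)
  round-node c k rewrite #neighbors-node c black k | #neighbors-node c white k =
    majority-of-two (c (node k)) _ (c (node (2 + k)))

-- Alternating paths traced through time.

module MedianDynamics {n : ℕ} .{{_ : NonZero n}} (G : Graph n) (round-node : Nodes.RoundIsMedian n G) where

  open Nodes n
  open MajorityModel G

  moves⇒isolated : ∀ c k → round c (node (suc k)) ≢ c (node (suc k)) →
                   c (node k) ≢ c (node (suc k)) × c (node (suc k)) ≢ c (node (2 + k))
  moves⇒isolated c k moves = maj≢⇒isolated _ _ _ (moves ∘ trans (round-node c k))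

  isolated⇒moves : ∀ c k → c (node k) ≢ c (node (suc k)) × c (node (suc k)) ≢ c (node (2 + k)) →
                   round c (node (suc k)) ≢ c (node (suc k))
  isolated⇒moves c k isolated = isolated⇒maj≢ _ _ _ isolated ∘ trans (sym (round-node c k))

  round-cong : ∀ {c d} → c ≗ d → round c ≗ round d
  round-cong {c} {d} c≗d = ∀-node 1 λ k →
    trans (round-node c k) (trans (maj-cong (c≗d _) (c≗d _) (c≗d _)) (sym (round-node d k)))

  after-cong : ∀ t {c d} → c ≗ d → after t c ≗ after t d
  after-cong zero    c≗d = c≗d
  after-cong (suc t) c≗d = round-cong (after-cong t c≗d)

  after-comm : ∀ s t c → after s (after t c) ≡ after t (after s c)
  after-comm s t c = trans (sym (fold-+ c round s))
    (trans (cong (λ i → after i c) (+-comm s t)) (fold-+ c round t))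

  -- Like step, indexed by the left end of the initial window: position k at time t is node k + t.
  cone : Coloring n → ℕ → ℕ → Color
  cone c t k = after t c (node (k + t))

  cone-suc : ∀ c t → cone c (suc t) ≗ step (cone c t)
  cone-suc c t k rewrite +-suc k t = round-node (after t c) (k + t)

  -- Undoing a round lengthens the path by one edge at each end, hence the summand `t * 2`.
  cone-alternates⁻ : ∀ c t k i → Alternates (cone c t) k (2 + i) →
                     Alternates (cone c 0) k (2 + (t * 2 + i))
  cone-alternates⁻ c zero    k i a = a
  cone-alternates⁻ c (suc t) k i a =
    subst (Alternates (cone c 0) k ∘ (2 +_)) (trans (+-suc (t * 2) (suc i)) (cong suc (+-suc (t * 2) i)))
      (cone-alternates⁻ c t k (2 + i)
        (Alternates-step⁻ (cone c t) k i (Alternates-resp-≗ (cone-suc c t) k (2 + i) a)))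

  cone-alternates⁺ : ∀ c t k i → Alternates (cone c 0) k (t * 2 + i) → Alternates (cone c t) k i
  cone-alternates⁺ c zero    k i a = a
  cone-alternates⁺ c (suc t) k i a =
    Alternates-resp-≗ (sym ∘ cone-suc c t) k i
      (Alternates-step⁺ (cone c t) k i
        (cone-alternates⁺ c t k (2 + i)
          (subst (Alternates (cone c 0) k)
            (sym (trans (+-suc (t * 2) (suc i)) (cong suc (+-suc (t * 2) i)))) a)))

  FullyAlternating : Coloring n → Set
  FullyAlternating c = ∀ k → c (node k) ≢ c (node (suc k))

  Alternates-around : ∀ c k {i} → n ≤ i → Alternates (cone c 0) k i → FullyAlternating c
  -- Since `l + k` and `j` agree modulo `n`, the edge at `j` is the one at offset `l % n` in the
  -- path, and this offset is below `n`.
  Alternates-around c k n≤i a j with l , eq ← shifted k j =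
    subst₂ (λ u v → c u ≢ c v) (to 0) (to 1)
      (subst (λ i → c (node i) ≢ c (node (suc i))) (+-identityʳ _)
        (Alternates-lookup k a (<-≤-trans (m%n<n l n) n≤i)))
    where
    open ≡-Reasoning
    to : ∀ d → node (d + (l % n + k)) ≡ node (d + j)
    to d = begin
      node (d + (l % n + k))                 ≡⟨ node-periodic _ (l / n) ⟨
      node (d + (l % n + k) + l / n * n)     ≡⟨ cong node (+-assoc d _ _) ⟩
      node (d + (l % n + k + l / n * n))     ≡⟨ cong (node ∘ (d +_)) (+-assoc (l % n) k _) ⟩
      node (d + (l % n + (k + l / n * n)))   ≡⟨ cong (λ x → node (d + (l % n + x))) (+-comm k _) ⟩
      node (d + (l % n + (l / n * n + k)))   ≡⟨ cong (node ∘ (d +_)) (+-assoc (l % n) _ k) ⟨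
      node (d + (l % n + l / n * n + k))     ≡⟨ cong (λ x → node (d + (x + k))) (m≡m%n+[m/n]*n l n) ⟨
      node (d + (l + k))                     ≡⟨ cong (node ∘ (d +_)) eq ⟩
      node (d + (j + k * n))                 ≡⟨ cong node (+-assoc d j _) ⟨
      node (d + j + k * n)                   ≡⟨ node-periodic (d + j) k ⟩
      node (d + j)                           ∎

  -- A node that moves at time `t` has two alternating edges there, which grow to `2 + t * 2`
  -- initial edges, enough to go all around.
  fixed-or-alternating : ∀ c t → n ≤ 2 + t * 2 → round (after t c) ≗ after t c ⊎ FullyAlternating c
  fixed-or-alternating c t n≤ with all? (λ v → round (after t c) v ≟ᶜ after t c v)
  ... | yes fixed = inj₁ fixed
  ... | no ¬fixed
    with v , moves ← ¬∀⟶∃¬ n _ (λ v → round (after t c) v ≟ᶜ after t c v) ¬fixed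
    -- Offset `suc t` makes the moving node the middle of the two cone edges that start at position
    -- `k` at time `t`.
    with k , refl ← node-surjective (suc t) v
    rewrite +-suc k t
    with p , q ← moves⇒isolated (after t c) (k + t) moves
    = inj₂ (Alternates-around c k (≤-trans n≤ (≤-reflexive (cong (2 +_) (sym (+-identityʳ _)))))
        (cone-alternates⁻ c t k 0 (p , q , _)))

  -- Recurrence as a period of two rounds.

  -- A decidable substitute for `Recurrent`, whose period is unbounded; the two turn out to be
  -- equivalent.
  Settled : Coloring n → Set
  Settled c = after 2 c ≗ c

  settled? : Decidable Settled
  settled? c = all? λ v → after 2 c v ≟ᶜ c v

  Settled-after : ∀ t {c} → Settled c → Settled (after t c)
  Settled-after t {c} s v = trans (cong-app (after-comm 2 t c) v) (after-cong t s v)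

  Settled-resp-≗ : ∀ {c d} → c ≗ d → Settled c → Settled d
  Settled-resp-≗ c≗d s v = trans (sym (after-cong 2 c≗d v)) (trans (s v) (c≗d v))

  alternating⇒settled : ∀ c → FullyAlternating c → Settled c
  alternating⇒settled c a = ∀-node 2 λ k →
    trans (round-node (round c) (suc k))
      (trans (maj-cong (round-node c k) (round-node c (1 + k)) (round-node c (2 + k)))
        (alternating⇒maj∘maj (x k) (x (1 + k)) (x (2 + k)) (x (3 + k)) (x (4 + k))
          (a k , a (1 + k) , a (2 + k) , a (3 + k))))
    where
    x : ℕ → Color
    x = c ∘ node

  settles : ∀ c t → n ≤ 2 + t * 2 → Settled (after t c)
  settles c t n≤ with fixed-or-alternating c t n≤
  ... | inj₁ fixed = λ v → trans (round-cong fixed v) (fixed v)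
  ... | inj₂ a     = Settled-after t (alternating⇒settled c a)

  settled⇒recurrent : ∀ c → Settled c → Recurrent c
  settled⇒recurrent c s = 2 , s≤s z≤n , s

  after-multiple : ∀ {c p} → after p c ≗ c → ∀ k → after (k * p) c ≗ c
  after-multiple e zero = λ _ → refl
  after-multiple {c} {p} e (suc k) v =
    trans (cong-app (fold-+ c round p) v) (trans (after-cong p (after-multiple e k) v) (e v))

  recurrent⇒settled : ∀ c → Recurrent c → Settled c
  recurrent⇒settled c (p@(suc _) , _ , e) =
    -- After `n * p` rounds the coloring has returned to itself, and as `p` is positive this is late
    -- enough for `settles`.
    Settled-resp-≗ (after-multiple e n) (settles c (n * p) (begin
      n               ≤⟨ m≤m*n n p ⟩
      n * p           ≤⟨ m≤m*n (n * p) 2 ⟩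
      n * p * 2       ≤⟨ m≤n+m _ 2 ⟩
      2 + n * p * 2   ∎))
    where open ≤-Reasoning

  -- The first settled time is found by a bounded search, and is also the first recurrent time by
  -- the equivalence.
  stabilizes-by : ∀ T → n ≤ 2 + T * 2 → ∀ c → ∃[ t ] (IsStabilizationTime c t × t ≤ T)
  stabilizes-by T n≤ c with least (λ t → settled? (after t c)) T (settles c T n≤)
  ... | t , settled , t≤ , t-min =
    t , (settled⇒recurrent _ settled , λ s → t-min s ∘ recurrent⇒settled _) , t≤

  -- A coloring attaining the bound.

  module Slowest (h : ℕ) (n≤2+2T : n ≤ 2 + suc h * 2) (2T<n : suc h * 2 < n) where

    2T : ℕ
    2T = suc h * 2

    -- Stripes on 0, …, 2T, whose ends are black, and a last black node if n is even: a longest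
    -- alternating path in a coloring that is not fully alternating.
    slowest : Coloring n
    slowest v = striped (toℕ v ⊓ 2T)

    slowest-node : ∀ j → j < n → slowest (node j) ≡ striped (j ⊓ 2T)
    slowest-node j j<n = cong (striped ∘ (_⊓ 2T)) (trans (toℕ-node j) (m<n⇒m%n≡m j<n))

    slowest-striped : ∀ {j} → j ≤ 2T → slowest (node j) ≡ striped j
    slowest-striped j≤ = trans (slowest-node _ (≤-<-trans j≤ 2T<n)) (cong striped (m≤n⇒m⊓n≡m j≤))

    slowest-alternates : Alternates (cone slowest 0) 0 2T
    slowest-alternates = Alternates-tabulate 0 2T λ j j< →
      subst (λ i → slowest (node i) ≢ slowest (node (suc i))) (sym (trans (+-identityʳ (j + 0)) (+-identityʳ j)))
      (subst₂ _≢_ (sym (slowest-striped (<⇒≤ j<))) (sym (slowest-striped j<)) (striped-alternates j))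

    -- The closing edge, from the last node back to node 0, joins two black nodes for either parity
    -- of `n`.
    slowest-¬alternating : ¬ FullyAlternating slowest
    slowest-¬alternating a = a (pred n) (begin
      slowest (node (pred n))       ≡⟨ slowest-node (pred n) (≤-reflexive (suc-pred n)) ⟩
      striped (pred n ⊓ 2T)         ≡⟨ cong striped (m≥n⇒m⊓n≡n (<⇒≤pred 2T<n)) ⟩
      striped 2T                    ≡⟨ striped-even h ⟩
      black                         ≡⟨ cong (striped ∘ (_⊓ 2T)) (trans (toℕ-node n) (n%n≡0 n)) ⟨
      slowest (node n)              ≡⟨ cong (slowest ∘ node) (suc-pred n) ⟨
      slowest (node (suc (pred n))) ∎)
      where open ≡-Reasoning

    -- Node `h + 1`, the centre of the stripes, still moves in round `h + 1`, after which everything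
    -- is fixed. Period two at time `h` would force its colors at times `h` and `h + 1` to agree.
    slowest-unsettled : ¬ Settled (after h slowest)
    slowest-unsettled s
      with p , q , _ ← cone-alternates⁺ slowest h 0 2
             (subst (Alternates (cone slowest 0) 0) (+-comm 2 (h * 2)) slowest-alternates)
      with fixed-or-alternating slowest (suc h) n≤2+2T
    ... | inj₂ a     = slowest-¬alternating a
    ... | inj₁ fixed = isolated⇒moves _ h (p , q) (trans (sym (fixed _)) (s _))

    -- Settledness persists, so recurrence at any time up to `h` would carry over to time `h`.
    slowest-time : IsStabilizationTime slowest (suc h)
    slowest-time = settled⇒recurrent _ (settles slowest (suc h) n≤2+2T) , λ s r → ≮⇒≥ λ s≤h →
      slowest-unsettled (subst Settled
        (trans (sym (fold-+ slowest round (h ∸ s))) (cong (λ t → after t slowest) (m∸n+n≡m (≤-pred s≤h))))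
        (Settled-after (h ∸ s) (recurrent⇒settled _ r)))

theorem2p3 : (n : ℕ) (3≤n : 3 ≤ n) →
    let open MajorityModel (cycleGraph n 3≤n) in
    ((c : Coloring n) → ∃[ t ] (IsStabilizationTime c t × t ≤ ⌈ n /2⌉ ∸ 1))
    × (∃[ c ] IsStabilizationTime c (⌈ n /2⌉ ∸ 1))
-- For `n = 3 + m`, the bound `⌈ n /2⌉ ∸ 1` computes to `suc ⌊ m /2⌋`.
theorem2p3 n@(suc (suc (suc m))) 3≤n = stabilizes-by (suc ⌊ m /2⌋) n≤2+2T , slowest , slowest-time
  where
  n≤2+2T : n ≤ 2 + suc ⌊ m /2⌋ * 2
  n≤2+2T = s≤s (s≤s (s≤s (k≤1+⌊k/2⌋*2 m)))

  open MedianDynamics (cycleGraph n 3≤n) (CycleGraph.round-node n 3≤n)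
  open Slowest ⌊ m /2⌋ n≤2+2T (s≤s (s≤s (s≤s (⌊k/2⌋*2≤k m))))
theorem2p3 1 (s≤s ())
theorem2p3 2 (s≤s (s≤s ()))
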